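{- Let $N$ be a simple cographic matroid of rank $n-1$, and let $c$ be a colouring of the ground set $E(N)$ using $n$ colours such that each colour class has size at least $2$. Then $N$ has a circuit of size at most $\lceil n/2 \rceil$ whose elements all have distinct colours (a rainbow circuit).
   Context: A matroid is a finite ground set $E$ with a collection of nonempty, inclusion-incomparable subsets called circuits satisfying the circuit elimination axiom. A set is independent if it contains no circuit; the rank of the matroid is the size of a largest independent set. A matroid is simple if it has no circuits of size $1$ or $2$. For a graph $G$, an edge-cut is a set $C^*$ of edges such that $G \setminus C^*$ has more connected components than $G$; a cocycle is an inclusion-minimal edge-cut. The cocycle matroid $M(G)^*$ has ground set $E(G)$ and circuits the cocycles of $G$. A matroid is cographic if it is isomorphic to $M(G)^*$ for some graph $G$. -}

module Defs where

open import Data.Nat using (ℕ; suc; _≤_; _<_)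
open import Data.Fin using (Fin; _≟_)
open import Data.Fin.Subset using (Subset; _∈_; _∉_; _⊆_; _∪_; ∣_∣; Nonempty)
open import Data.Vec using (tabulate)
open import Data.Product using (Σ; ∃; _×_; _,_)
open import Data.Sum using (_⊎_)
open import Relation.Nullary using (¬_; does)
open import Relation.Binary.PropositionalEquality using (_≡_; _≢_)

record Matroid (m : ℕ) : Set₁ where
  field
    Circuit     : Subset m → Set
    nonempty    : ∀ C → Circuit C → Nonempty C
    incomparable : ∀ C D → Circuit C → Circuit D → C ⊆ D → C ≡ D
    elimination : ∀ C D (e : Fin m) → Circuit C → Circuit D → C ≢ D →
                  e ∈ C → e ∈ D →
                  Σ (Subset m) λ F → Circuit F × F ⊆ (C ∪ D) × e ∉ F

module _ {m : ℕ} (M : Matroid m) where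
  open Matroid M

  Independent : Subset m → Set
  Independent I = ∀ C → Circuit C → ¬ (C ⊆ I)

  HasRank : ℕ → Set
  HasRank r = (Σ (Subset m) λ I → Independent I × ∣ I ∣ ≡ r)
            × (∀ I → Independent I → ∣ I ∣ ≤ r)

  Simple : Set
  Simple = ∀ C → Circuit C → ∣ C ∣ ≢ 1 × ∣ C ∣ ≢ 2

record Graph (m : ℕ) : Set where
  field
    v    : ℕ
    ends : Fin m → Fin v × Fin v

module _ {m : ℕ} (G : Graph m) where
  open Graph G

  Adj : Fin v → Fin v → Fin m → Set
  Adj x y e = ends e ≡ (x , y) ⊎ ends e ≡ (y , x)

  data Connected (S : Subset m) : Fin v → Fin v → Set where
    here : ∀ {x} → Connected S x x
    step : ∀ {x y z} (e : Fin m) → e ∉ S → Adj x y e →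
           Connected S y z → Connected S x z

  -- G \ S has exactly k connected components: a surjective labelling of
  -- vertices by Fin k identifying exactly the connected pairs.
  HasComponents : Subset m → ℕ → Set
  HasComponents S k = Σ (Fin v → Fin k) λ f →
      (∀ (i : Fin k) → ∃ λ x → f x ≡ i)
    × (∀ x y → f x ≡ f y → Connected S x y)
    × (∀ x y → Connected S x y → f x ≡ f y)

  none : Subset m
  none = tabulate (λ _ → Data.Bool.false)
    where import Data.Bool

  EdgeCut : Subset m → Set
  EdgeCut S = ∀ k k' → HasComponents none k → HasComponents S k' → k < k'

  Cocycle : Subset m → Set
  Cocycle S = EdgeCut S × (∀ T → T ⊆ S → EdgeCut T → T ≡ S)

Cographic : ∀ {m} → Matroid m → Set
Cographic {m} N = Σ (Graph m) λ G →
  ∀ C → (Matroid.Circuit N C → Cocycle G C) × (Cocycle G C → Matroid.Circuit N C)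

colourClass : ∀ {m n} → (Fin m → Fin n) → Fin n → Subset m
colourClass c i = tabulate (λ e → does (c e ≟ i))

Rainbow : ∀ {m n} → (Fin m → Fin n) → Subset m → Set
Rainbow c C = ∀ x y → x ∈ C → y ∈ C → c x ≡ c y → x ≡ y

{-# OPTIONS --safe #-}
-- Keep two edges of each colour and contract all others: the cuts of the resulting
-- graph are cuts of G, and the rank hypothesis says that its rank is at least n + 1.
-- Contracting a colour that contains a loop, or whose two edges are parallel, lowers
-- both n and the rank by at most one, so assume there is none; isolated vertices can be
-- merged away. Then each colour has both edges at no more than one vertex, so at most n of
-- the at least n + 2 vertices have a star that is not rainbow. As the degrees are at least 3
-- and add up to 4 n, two rainbow stars have total size at most n.
module Submission where

open import Defs
import Data.Bool.Properties as Bool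
import Data.Fin.Properties as Fin
import Data.Nat as ℕ
open import Data.Bool using (Bool; true; false; _∧_; _∨_; _xor_)
open import Data.Fin using (Fin; zero; suc; punchIn; punchOut)
open import Data.Fin.Properties using (_≟_; any?; injective⇒≤; punchInᵢ≢i; punchIn-punchOut;
  punchOut-punchIn; punchOut-cong; punchOut-injective)
open import Data.Fin.Subset using (Subset; _∈_; _∉_; _⊆_; ∣_∣; Nonempty; _-_; ⊤)
open import Data.Fin.Subset.Properties using (_∈?_; ⊆-refl; ⊆-trans; ⊆-antisym; ⊆-max; p⊆q⇒∣p∣≤∣q∣;
  p─q⊆p; p─⊥≡p; x∈p∧x≢y⇒x∈p-y; x∈p⇒∣p-x∣<∣p∣; ∈⊤)
open import Data.Nat using (ℕ; zero; suc; _+_; _*_; _≤_; _<_; z≤n; s≤s; ⌈_/2⌉; ⌊_/2⌋; _≤?_; _<?_)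
open import Data.Nat.Induction using (Acc; acc; <-wellFounded)
open import Data.Nat.Properties hiding (_≟_)
open import Data.Nat.Tactic.RingSolver using (solve-∀)
open import Data.Product using (Σ; ∃; _×_; _,_; proj₁; proj₂; swap)
open import Data.Product.Properties using (≡-dec)
open import Data.Sum using (_⊎_; inj₁; inj₂)
open import Data.Vec using ([]; _∷_; tabulate; lookup; here; there)
open import Data.Vec.Properties using (lookup∘tabulate; []=⇒lookup; lookup⇒[]=)
open import Function using (_∘_; id)
open import Relation.Binary.PropositionalEquality
open import Relation.Nullary using (¬_; Dec; yes; no; does; contradiction)
open import Relation.Nullary.Decidable using (_⊎-dec_; _×-dec_; ¬?; decidable-stable; dec-true)

open import Algebra.Properties.Semiring.Sum +-*-semiring
  using (sum; sum-remove; ∑-distrib-+; ∑-comm; *-distribˡ-sum)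

private
  variable
    k l m n w : ℕ

-- Finite sums and indicator functions

sum-mono-≤ : {f g : Fin n → ℕ} → (∀ i → f i ≤ g i) → sum f ≤ sum g
sum-mono-≤ {zero}  f≤g = z≤n
sum-mono-≤ {suc n} f≤g = +-mono-≤ (f≤g zero) (sum-mono-≤ (f≤g ∘ suc))

term≤sum : (f : Fin n → ℕ) (i : Fin n) → f i ≤ sum f
term≤sum {suc n} f i = ≤-trans (m≤m+n (f i) _) (≤-reflexive (sym (sum-remove {i = i} f)))

sum-const : ∀ n c → sum {n} (λ _ → c) ≡ n * c
sum-const zero    c = refl
sum-const (suc n) c = cong (c +_) (sum-const n c)

-- This is the form in which the double counts below use that an object is counted at most once.
sum-concentrated : (f : Fin n → ℕ) (b : ℕ) → (∀ i → f i ≤ b) →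
                   (∀ i j → f i ≢ 0 → f j ≢ 0 → i ≡ j) → sum f ≤ b
sum-concentrated {zero}  f b f≤b unique = z≤n
sum-concentrated {suc n} f b f≤b unique with f zero ℕ.≟ 0
... | yes f0≡0 = ≤-trans (≤-reflexive (cong (_+ sum (f ∘ suc)) f0≡0))
  (sum-concentrated (f ∘ suc) b (f≤b ∘ suc) λ i j p q → Fin.suc-injective (unique _ _ p q))
-- A nonzero first term forces all later ones to vanish, so the tail is bounded by `0` instead of
-- `b`.
... | no  f0≢0 = ≤-trans
  (+-mono-≤ (f≤b zero) (sum-concentrated (f ∘ suc) 0 rest≤0 λ i j p q → contradiction (n≤0⇒n≡0 (rest≤0 i)) p))
  (≤-reflexive (+-identityʳ b))
  where
  rest≤0 : ∀ i → f (suc i) ≤ 0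
  rest≤0 i with f (suc i) ℕ.≟ 0
  ... | yes eq = ≤-reflexive eq
  ... | no  ne with () ← unique zero (suc i) f0≢0 ne

⟦_⟧ : Bool → ℕ
⟦ true ⟧  = 1
⟦ false ⟧ = 0

⟦⟧≤1 : ∀ b → ⟦ b ⟧ ≤ 1
⟦⟧≤1 true  = ≤-refl
⟦⟧≤1 false = z≤n

⟦⟧≢0 : ∀ {b} → ⟦ b ⟧ ≢ 0 → b ≡ true
⟦⟧≢0 {true}  _  = refl
⟦⟧≢0 {false} ne = contradiction refl ne

⟦⟧-mono : ∀ {b c} → (b ≡ true → c ≡ true) → ⟦ b ⟧ ≤ ⟦ c ⟧
⟦⟧-mono {true}  b⇒c = ≤-reflexive (cong ⟦_⟧ (sym (b⇒c refl)))
⟦⟧-mono {false} b⇒c = z≤n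

∧-true : ∀ {b c} → b ∧ c ≡ true → b ≡ true × c ≡ true
∧-true {true} eq = refl , eq

≟-true : (x y : Fin n) → does (x ≟ y) ≡ true → x ≡ y
≟-true x y eq with yes p ← x ≟ y = p

≟-refl : (x : Fin n) → does (x ≟ x) ≡ true
≟-refl x = dec-true (x ≟ x) refl

sum-≟≤1 : (x : Fin n) → sum (λ y → ⟦ does (x ≟ y) ⟧) ≤ 1
sum-≟≤1 x = sum-concentrated _ 1 (λ y → ⟦⟧≤1 (does (x ≟ y)))
  λ i j p q → trans (sym (≟-true x i (⟦⟧≢0 p))) (≟-true x j (⟦⟧≢0 q))

-- Identifying two vertices

Surjection : (Fin k → Fin l) → Set
Surjection f = ∀ i → ∃ λ x → f x ≡ i

module Merge {w} (u v : Fin (suc w)) (u≢v : u ≢ v) where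

  -- Deleting `u` from the labels and sending it where `v` goes keeps the quotient of the form
  -- `Fin w`.
  merge : Fin (suc w) → Fin w
  merge x with u ≟ x
  ... | yes _   = punchOut u≢v
  ... | no  u≢x = punchOut u≢x

  merge-surjective : Surjection merge
  merge-surjective i = punchIn u i , lemma
    where
    lemma : merge (punchIn u i) ≡ i
    lemma with u ≟ punchIn u i
    ... | yes eq = contradiction (sym eq) (punchInᵢ≢i u i)
    ... | no  _  = trans (punchOut-cong u refl) (punchOut-punchIn u)

  merge-identifies : merge u ≡ merge v
  merge-identifies with u ≟ u | u ≟ v
  ... | no u≢u | _      = contradiction refl u≢u
  ... | yes _  | yes eq = contradiction eq u≢v
  ... | yes _  | no _   = punchOut-cong u refl

  merge-kernel : ∀ x y → merge x ≡ merge y → x ≡ y ⊎ (x ≡ u × y ≡ v) ⊎ (x ≡ v × y ≡ u)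
  merge-kernel x y eq with u ≟ x | u ≟ y
  ... | yes u≡x | yes u≡y = inj₁ (trans (sym u≡x) u≡y)
  ... | yes u≡x | no  u≢y = inj₂ (inj₁ (sym u≡x , sym (punchOut-injective u≢v u≢y eq)))
  ... | no  u≢x | yes u≡y = inj₂ (inj₂ (punchOut-injective u≢x u≢v eq , sym u≡y))
  ... | no  u≢x | no  u≢y = inj₁ (punchOut-injective u≢x u≢y eq)

open Merge

-- The vertices may already coincide, hence two bounds: at most one vertex is lost, as `Spread`
-- requires, and none is gained, as termination requires.
contract : (u v : Fin w) → Σ ℕ λ w′ → w ≤ suc w′ × w′ ≤ w × Σ (Fin w → Fin w′) λ q →
           Surjection q × q u ≡ q v
contract {suc w} u v with u ≟ v
... | yes u≡v = suc w , n≤1+n _ , ≤-refl , id , (λ i → i , refl) , u≡v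
... | no  u≢v = w , ≤-refl , n≤1+n _ , merge u v u≢v , merge-surjective u v u≢v , merge-identifies u v u≢v

-- Edges, cuts and stars

Edge : ℕ → Set
Edge w = Fin w × Fin w

Flat : {A : Set} → (Fin w → A) → Edge w → Set
Flat g (u , v) = g u ≡ g v

mapEdge : (Fin w → Fin k) → Edge w → Edge k
mapEdge q (u , v) = q u , q v

cut : (Fin w → Bool) → Edge w → Bool
cut X (u , v) = X u xor X v

xor-same : ∀ {b c} → b ≡ c → b xor c ≡ false
xor-same {true}  refl = refl
xor-same {false} refl = refl

xor-false : ∀ {b c} → b xor c ≡ false → b ≡ c
xor-false {true}  {true}  _ = refl
xor-false {false} {false} _ = refl

flat⇒uncut : (q : Fin w → Fin k) (X : Fin k → Bool) (e : Edge w) → Flat q e → cut X (mapEdge q e) ≡ false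
flat⇒uncut q X e flat = xor-same (cong X flat)

uncut⇒flat : ∀ X (e : Edge w) → cut X e ≢ true → X (proj₁ e) ≡ X (proj₂ e)
uncut⇒flat X e uncut = xor-false (Bool.¬-not uncut)

-- The cut of this set is the star of `x`; loops at `x` are not in it.
⁅_⁆ᵇ : Fin w → Fin w → Bool
⁅ x ⁆ᵇ y = does (y ≟ x)

Incident : Fin w → Edge w → Set
Incident x (u , v) = u ≡ x ⊎ v ≡ x

cut-singleton : (x : Fin w) (e : Edge w) → cut ⁅ x ⁆ᵇ e ≡ true → Incident x e
cut-singleton x (u , v) eq with u ≟ x | v ≟ x
... | yes p | _     = inj₁ p
... | no _  | yes q = inj₂ q

sum-cut-singleton : (e : Edge w) → sum (λ x → ⟦ cut ⁅ x ⁆ᵇ e ⟧) ≤ 2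
sum-cut-singleton (u , v) = begin
  sum (λ x → ⟦ does (u ≟ x) xor does (v ≟ x) ⟧)                      ≤⟨ sum-mono-≤ (λ x → xor≤+ (does (u ≟ x)) _) ⟩
  sum (λ x → ⟦ does (u ≟ x) ⟧ + ⟦ does (v ≟ x) ⟧)                    ≡⟨ ∑-distrib-+ (λ x → ⟦ does (u ≟ x) ⟧) _ ⟩
  sum (λ x → ⟦ does (u ≟ x) ⟧) + sum (λ x → ⟦ does (v ≟ x) ⟧)        ≤⟨ +-mono-≤ (sum-≟≤1 u) (sum-≟≤1 v) ⟩
  2                                                                  ∎
  where
  open ≤-Reasoning
  xor≤+ : ∀ b c → ⟦ b xor c ⟧ ≤ ⟦ b ⟧ + ⟦ c ⟧
  xor≤+ true  true  = z≤n
  xor≤+ true  false = ≤-refl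
  xor≤+ false c     = ≤-refl

Degenerate : Edge w → Edge w → Set
Degenerate e f = proj₁ e ≡ proj₂ e ⊎ proj₁ f ≡ proj₂ f ⊎ e ≡ f ⊎ e ≡ swap f

degenerate? : (e f : Edge w) → Dec (Degenerate e f)
degenerate? e f = (_ ≟ _) ⊎-dec (_ ≟ _) ⊎-dec ≡-dec _≟_ _≟_ e f ⊎-dec ≡-dec _≟_ _≟_ e (swap f)

-- Identifying the ends of one of the edges is enough: the other one is a loop already or is
-- parallel to it.
degenerate-collapse : (e f : Edge w) → Degenerate e f → Σ (Fin w) λ u → Σ (Fin w) λ v →
  ∀ {k} (q : Fin w → Fin k) → q u ≡ q v → Flat q e × Flat q f
degenerate-collapse e f (inj₁ loop)               = proj₁ f , proj₂ f , λ q eq → cong q loop , eq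
degenerate-collapse e f (inj₂ (inj₁ loop))        = proj₁ e , proj₂ e , λ q eq → eq , cong q loop
degenerate-collapse e f (inj₂ (inj₂ (inj₁ refl))) = proj₁ e , proj₂ e , λ q eq → eq , eq
degenerate-collapse e f (inj₂ (inj₂ (inj₂ refl))) = proj₁ e , proj₂ e , λ q eq → eq , sym eq

incident-both : {x y : Fin w} → x ≢ y → (e : Edge w) → Incident x e → Incident y e → e ≡ (x , y) ⊎ e ≡ (y , x)
incident-both x≢y e (inj₁ refl) (inj₁ refl) = contradiction refl x≢y
incident-both x≢y e (inj₁ refl) (inj₂ refl) = inj₁ refl
incident-both x≢y e (inj₂ refl) (inj₁ refl) = inj₂ refl
incident-both x≢y e (inj₂ refl) (inj₂ refl) = contradiction refl x≢y

-- Two distinct common ends determine both edges up to orientation, which makes them parallel.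
degenerate-if-two : {x y : Fin w} → x ≢ y → (e f : Edge w) →
  Incident x e → Incident y e → Incident x f → Incident y f → Degenerate e f
degenerate-if-two x≢y e f xe ye xf yf with incident-both x≢y e xe ye | incident-both x≢y f xf yf
... | inj₁ refl | inj₁ refl = inj₂ (inj₂ (inj₁ refl))
... | inj₁ refl | inj₂ refl = inj₂ (inj₂ (inj₂ refl))
... | inj₂ refl | inj₁ refl = inj₂ (inj₂ (inj₂ refl))
... | inj₂ refl | inj₂ refl = inj₂ (inj₂ (inj₁ refl))

-- Graphs with two edges of each colour

-- A graph on Fin w in which colour i consists of the edges a i and b i.
module Paired {n w} (a b : Fin n → Edge w) where

  Crosses : (Fin w → Bool) → Fin n → Set
  Crosses X i = cut X (a i) ≡ true ⊎ cut X (b i) ≡ true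

  crosses? : ∀ X i → Dec (Crosses X i)
  crosses? X i = (_ Bool.≟ _) ⊎-dec (_ Bool.≟ _)

  weight : (Fin w → Bool) → ℕ
  weight X = sum (λ i → ⟦ cut X (a i) ⟧ + ⟦ cut X (b i) ⟧)

  doubled : (Fin w → Bool) → ℕ
  doubled X = sum (λ i → ⟦ cut X (a i) ∧ cut X (b i) ⟧)

  -- The number of components is the largest j here, so this bounds the rank
  -- of the graph from below by n + 1.
  Spread : Set
  Spread = ∀ {j} (g : Fin w → Fin j) → Surjection g →
           (∀ i → Flat g (a i)) → (∀ i → Flat g (b i)) → j + suc n ≤ w

  -- The trace of simplicity: a nonempty cut contains a circuit, which has at least three elements.
  LargeCuts : Set
  LargeCuts = ∀ X i → Crosses X i → 3 ≤ weight X

  -- Doubling the size avoids rounding during the induction; `half` passes to the ceiling at the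
  -- end.
  ShortRainbowCut : Set
  ShortRainbowCut = Σ (Fin w → Bool) λ X → ∃ (Crosses X) × weight X + weight X ≤ n ×
                    (∀ i → cut X (a i) ≡ true → cut X (b i) ≢ true)

  doubled-rainbow : ∀ X → doubled X ≡ 0 → ∀ i → cut X (a i) ≡ true → cut X (b i) ≢ true
  doubled-rainbow X eq i p q = contradiction
    (subst₂ (λ s t → ⟦ s ∧ t ⟧ ≤ 0) p q
      (≤-trans (term≤sum (λ i → ⟦ cut X (a i) ∧ cut X (b i) ⟧) i) (≤-reflexive eq)))
    λ ()

  -- Handshake count: each of the `2 n` edges lies in at most two stars.
  sum-degrees : sum (λ x → weight ⁅ x ⁆ᵇ) ≤ n * 4
  sum-degrees = begin
    sum (λ x → weight ⁅ x ⁆ᵇ)                                        ≡⟨ ∑-comm (λ x i → ⟦ cut ⁅ x ⁆ᵇ (a i) ⟧ + ⟦ cut ⁅ x ⁆ᵇ (b i) ⟧) ⟩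
    sum (λ i → sum (λ x → ⟦ cut ⁅ x ⁆ᵇ (a i) ⟧ + ⟦ cut ⁅ x ⁆ᵇ (b i) ⟧)) ≤⟨ sum-mono-≤ per-colour ⟩
    sum (λ (_ : Fin n) → 4)                                          ≡⟨ sum-const n 4 ⟩
    n * 4                                                            ∎
    where
    open ≤-Reasoning
    per-colour : ∀ i → sum (λ x → ⟦ cut ⁅ x ⁆ᵇ (a i) ⟧ + ⟦ cut ⁅ x ⁆ᵇ (b i) ⟧) ≤ 4
    per-colour i = ≤-trans (≤-reflexive (∑-distrib-+ (λ x → ⟦ cut ⁅ x ⁆ᵇ (a i) ⟧) _))
      (+-mono-≤ (sum-cut-singleton (a i)) (sum-cut-singleton (b i)))

  -- A colour contributes to at most one star, since two vertices meeting both of its edges would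
  -- make these parallel.
  sum-doubled : (∀ i → ¬ Degenerate (a i) (b i)) → sum (λ x → doubled ⁅ x ⁆ᵇ) ≤ n
  sum-doubled proper = begin
    sum (λ x → doubled ⁅ x ⁆ᵇ)                                       ≡⟨ ∑-comm (λ x i → ⟦ cut ⁅ x ⁆ᵇ (a i) ∧ cut ⁅ x ⁆ᵇ (b i) ⟧) ⟩
    sum (λ i → sum (λ x → ⟦ cut ⁅ x ⁆ᵇ (a i) ∧ cut ⁅ x ⁆ᵇ (b i) ⟧))  ≤⟨ sum-mono-≤ per-colour ⟩
    sum (λ (_ : Fin n) → 1)                                          ≡⟨ sum-const n 1 ⟩
    n * 1                                                            ≡⟨ *-identityʳ n ⟩
    n                                                                ∎
    where
    open ≤-Reasoning
    incident : ∀ i x → ⟦ cut ⁅ x ⁆ᵇ (a i) ∧ cut ⁅ x ⁆ᵇ (b i) ⟧ ≢ 0 → Incident x (a i) × Incident x (b i)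
    incident i x ne with ∧-true (⟦⟧≢0 ne)
    ... | p , q = cut-singleton x (a i) p , cut-singleton x (b i) q

    per-colour : ∀ i → sum (λ x → ⟦ cut ⁅ x ⁆ᵇ (a i) ∧ cut ⁅ x ⁆ᵇ (b i) ⟧) ≤ 1
    per-colour i = sum-concentrated _ 1 (λ x → ⟦⟧≤1 (cut ⁅ x ⁆ᵇ (a i) ∧ cut ⁅ x ⁆ᵇ (b i))) λ x y p q →
      decidable-stable (x ≟ y) λ x≢y → proper i (degenerate-if-two x≢y (a i) (b i)
        (proj₁ (incident i x p)) (proj₁ (incident i y q)) (proj₂ (incident i x p)) (proj₂ (incident i y q)))

  -- A star that is not rainbow has doubled ≥ 1 and weight ≥ 3, and a long star has
  -- 2 weight ≥ n + 1; either way 2 weight + (n - 5) doubled ≥ n + 1. Summing over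
  -- w ≥ n + 2 vertices gives (n + 2)(n + 1) ≤ 8 n + (n - 5) n, which is false.
  -- That n ≥ 6 follows from 3 w ≤ 4 n.
  count-stars : n + 2 ≤ w → (∀ x → 3 ≤ weight ⁅ x ⁆ᵇ) → (∀ i → ¬ Degenerate (a i) (b i)) →
    ¬ (∀ x → ¬ (doubled ⁅ x ⁆ᵇ ≡ 0 × weight ⁅ x ⁆ᵇ + weight ⁅ x ⁆ᵇ ≤ n))
  count-stars n+2≤w large proper bad = <-irrefl refl (<-≤-trans total< total)
    where
    open ≤-Reasoning
    6≤n : 6 ≤ n
    6≤n = +-cancelˡ-≤ (n * 3) 6 n (begin
      n * 3 + 6                 ≡⟨ *-distribʳ-+ 3 n 2 ⟨
      (n + 2) * 3               ≤⟨ *-monoˡ-≤ 3 n+2≤w ⟩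
      w * 3                     ≡⟨ sum-const w 3 ⟨
      sum (λ (_ : Fin w) → 3)   ≤⟨ sum-mono-≤ large ⟩
      sum (λ x → weight ⁅ x ⁆ᵇ) ≤⟨ sum-degrees ⟩
      n * 4                     ≡⟨ 4n≡3n+n n ⟩
      n * 3 + n                 ∎)
      where
      4n≡3n+n : ∀ n → n * 4 ≡ n * 3 + n
      4n≡3n+n = solve-∀

    -- `p` is `n - 5`, written additively for the ring solver.
    p : ℕ
    p = proj₁ (m≤n⇒∃[o]m+o≡n (≤-trans (n≤1+n 5) 6≤n))

    5+p≡n : 5 + p ≡ n
    5+p≡n = proj₂ (m≤n⇒∃[o]m+o≡n (≤-trans (n≤1+n 5) 6≤n))

    per-vertex : ∀ x → suc n ≤ 2 * weight ⁅ x ⁆ᵇ + p * doubled ⁅ x ⁆ᵇ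
    per-vertex x with doubled ⁅ x ⁆ᵇ ℕ.≟ 0
    ... | yes eq = begin
      suc n                                         ≤⟨ ≰⇒> (λ short → bad x (eq , short)) ⟩
      weight ⁅ x ⁆ᵇ + weight ⁅ x ⁆ᵇ                 ≡⟨ cong (weight ⁅ x ⁆ᵇ +_) (+-identityʳ (weight ⁅ x ⁆ᵇ)) ⟨
      2 * weight ⁅ x ⁆ᵇ                             ≤⟨ m≤m+n _ _ ⟩
      2 * weight ⁅ x ⁆ᵇ + p * doubled ⁅ x ⁆ᵇ        ∎
    ... | no ne = begin
      suc n                                         ≡⟨ cong suc 5+p≡n ⟨
      6 + p                                         ≡⟨ cong (6 +_) (*-identityʳ p) ⟨
      2 * 3 + p * 1                                 ≤⟨ +-mono-≤ (*-monoʳ-≤ 2 (large x)) (*-monoʳ-≤ p (n≢0⇒n>0 ne)) ⟩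
      2 * weight ⁅ x ⁆ᵇ + p * doubled ⁅ x ⁆ᵇ        ∎

    total : (n + 2) * suc n ≤ 2 * (n * 4) + p * n
    total = begin
      (n + 2) * suc n                                                      ≤⟨ *-monoˡ-≤ (suc n) n+2≤w ⟩
      w * suc n                                                            ≡⟨ sum-const w (suc n) ⟨
      sum (λ (_ : Fin w) → suc n)                                          ≤⟨ sum-mono-≤ per-vertex ⟩
      sum (λ x → 2 * weight ⁅ x ⁆ᵇ + p * doubled ⁅ x ⁆ᵇ)                    ≡⟨ ∑-distrib-+ (λ x → 2 * weight ⁅ x ⁆ᵇ) _ ⟩
      sum (λ x → 2 * weight ⁅ x ⁆ᵇ) + sum (λ x → p * doubled ⁅ x ⁆ᵇ)        ≡⟨ cong₂ _+_ (*-distribˡ-sum 2 (λ x → weight ⁅ x ⁆ᵇ))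
                                                                                        (*-distribˡ-sum p (λ x → doubled ⁅ x ⁆ᵇ)) ⟨
      2 * sum (λ x → weight ⁅ x ⁆ᵇ) + p * sum (λ x → doubled ⁅ x ⁆ᵇ)        ≤⟨ +-mono-≤ (*-monoʳ-≤ 2 sum-degrees) (*-monoʳ-≤ p (sum-doubled proper)) ⟩
      2 * (n * 4) + p * n                                                  ∎

    total< : 2 * (n * 4) + p * n < (n + 2) * suc n
    total< = subst (λ n → 2 * (n * 4) + p * n < (n + 2) * suc n) 5+p≡n
      -- The right side exceeds the left by exactly 2: one for strictness and one to spare.
      (≤-trans (m≤m+n _ 1) (≤-reflexive (identity p)))
      where
      identity : ∀ p → suc (2 * ((5 + p) * 4) + p * (5 + p)) + 1 ≡ (5 + p + 2) * suc (5 + p)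
      identity = solve-∀

open Paired

-- Contracting a colour and merging an isolated vertex

punchIn-elim : (P : Fin (suc n) → Set) (i : Fin (suc n)) → P i → (∀ k → P (punchIn i k)) → ∀ k → P k
punchIn-elim P i Pi Pin k with i ≟ k
... | yes refl = Pi
... | no  i≢k  = subst P (punchIn-punchOut i≢k) (Pin (punchOut i≢k))

module ContractColour {n w k} (a b : Fin (suc n) → Edge w) (i : Fin (suc n)) (q : Fin w → Fin k)
  (flat-a : Flat q (a i)) (flat-b : Flat q (b i)) where

  a′ b′ : Fin n → Edge k
  a′ = mapEdge q ∘ a ∘ punchIn i
  b′ = mapEdge q ∘ b ∘ punchIn i

  weight-contract : ∀ X → weight a b (X ∘ q) ≡ weight a′ b′ X
  weight-contract X = trans (sum-remove {i = i} (λ j → ⟦ cut (X ∘ q) (a j) ⟧ + ⟦ cut (X ∘ q) (b j) ⟧))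
    (cong (_+ weight a′ b′ X)
      (cong₂ (λ s t → ⟦ s ⟧ + ⟦ t ⟧) (flat⇒uncut q X (a i) flat-a) (flat⇒uncut q X (b i) flat-b)))

  -- One colour and at most one vertex disappear, so the inequality survives. Labellings pull back
  -- because `q` already collapses colour `i`.
  spread-contract : Surjection q → w ≤ suc k → Spread a b → Spread a′ b′
  spread-contract q-surj w≤ spread {j} g g-surj ga gb = ≤-pred (begin
    suc (j + suc n)   ≡⟨ +-suc j (suc n) ⟨
    j + suc (suc n)   ≤⟨ spread (g ∘ q) surj
                           (punchIn-elim (λ i → Flat (g ∘ q) (a i)) i (cong g flat-a) ga)
                           (punchIn-elim (λ i → Flat (g ∘ q) (b i)) i (cong g flat-b) gb) ⟩
    w                 ≤⟨ w≤ ⟩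
    suc k             ∎)
    where
    open ≤-Reasoning
    surj : Surjection (g ∘ q)
    surj c with g-surj c
    ... | y , refl with q-surj y
    ... | x , refl = x , refl

  large-contract : LargeCuts a b → LargeCuts a′ b′
  large-contract large X j crosses = ≤-trans (large (X ∘ q) (punchIn i j) crosses) (≤-reflexive (weight-contract X))

  lift : ShortRainbowCut a′ b′ → ShortRainbowCut a b
  lift (X , (j , crosses) , short , rainbow) =
    X ∘ q , (punchIn i j , crosses) ,
    ≤-trans (≤-reflexive (cong₂ _+_ (weight-contract X) (weight-contract X))) (≤-trans short (n≤1+n n)) ,
    punchIn-elim (λ i → cut (X ∘ q) (a i) ≡ true → cut (X ∘ q) (b i) ≢ true) i
      -- The pulled-back cut misses colour `i` altogether.
      (λ p _ → contradiction (trans (sym (flat⇒uncut q X (a i) flat-a)) p) λ ()) rainbow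

module MergeIsolated {n w} (a b : Fin n → Edge (suc w)) (x y : Fin (suc w)) (x≢y : x ≢ y)
  (isolated : ¬ ∃ (Crosses a b ⁅ x ⁆ᵇ)) where

  q : Fin (suc w) → Fin w
  q = merge x y x≢y

  a′ b′ : Fin n → Edge w
  a′ = mapEdge q ∘ a
  b′ = mapEdge q ∘ b

  spread-merge : Spread a b → Spread a′ b′
  spread-merge spread {j} g g-surj ga gb =
    ≤-pred (spread g⁺ surj (λ i → flat (a i) (λ c → isolated (i , inj₁ c)) (ga i))
                           (λ i → flat (b i) (λ c → isolated (i , inj₂ c)) (gb i)))
    where
    -- No edge but a loop meets `x`, so `x` may carry a label of its own. This extra component
    -- balances the vertex lost by merging.
    g⁺ : Fin (suc w) → Fin (suc j)
    g⁺ z with z ≟ x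
    ... | yes _ = zero
    ... | no  _ = suc (g (q z))

    g⁺-x : g⁺ x ≡ zero
    g⁺-x with x ≟ x
    ... | yes _ = refl
    ... | no ne = contradiction refl ne

    g⁺-≢ : ∀ z → z ≢ x → g⁺ z ≡ suc (g (q z))
    g⁺-≢ z ne with z ≟ x
    ... | yes eq = contradiction eq ne
    ... | no _   = refl

    surj : Surjection g⁺
    surj zero = x , g⁺-x
    surj (suc c) with g-surj c
    ... | t , refl with merge-surjective x y x≢y t
    ... | z , refl with z ≟ x
    ... | no  z≢x  = z , g⁺-≢ z z≢x
    -- Here `x` has given up its old label, and `y`, which has the same image under `q`, carries it
    -- instead.
    ... | yes refl = y , trans (g⁺-≢ y (x≢y ∘ sym)) (cong (suc ∘ g) (sym (merge-identifies x y x≢y)))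

    flat : ∀ e → cut ⁅ x ⁆ᵇ e ≢ true → Flat g (mapEdge q e) → Flat g⁺ e
    flat (u , v) uncut gq with u ≟ x | v ≟ x
    ... | yes refl | yes refl = refl
    ... | yes _    | no _     = contradiction refl uncut
    ... | no _     | yes _    = contradiction refl uncut
    ... | no _     | no _     = cong suc gq

  lift : ShortRainbowCut a′ b′ → ShortRainbowCut a b
  lift (X , short) = X ∘ q , short

-- Existence of a short rainbow cut

Fin1-unique : (i j : Fin 1) → i ≡ j
Fin1-unique zero zero = refl

-- Induction on `n + w`. Merging an isolated vertex lowers `w`; contracting a degenerate colour
-- lowers `n` and does not raise `w`. When neither applies, `count-stars` provides a short rainbow
-- star.
short-rainbow-cut : (a b : Fin n → Edge w) → Acc _<_ (n + w) → Spread a b → LargeCuts a b → ShortRainbowCut a b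
-- With at most one vertex the identity labelling is flat, and `Spread` would give `w + suc n ≤ w`.
short-rainbow-cut {w = zero} a b _ spread large
  with () ← spread id (λ i → i , refl) (λ i → contradiction (proj₁ (a i)) λ ()) (λ i → contradiction (proj₁ (a i)) λ ())
short-rainbow-cut {n} {suc zero} a b _ spread large
  with s≤s () ← spread {1} id (λ i → i , refl) (λ i → Fin1-unique _ _) (λ i → Fin1-unique _ _)
short-rainbow-cut {n} {suc (suc w)} a b (acc rec) spread large
  with any? (λ x → ¬? (any? (crosses? a b ⁅ x ⁆ᵇ)))
... | yes (x , isolated) = lift (short-rainbow-cut a′ b′ (rec (+-monoʳ-< n ≤-refl)) (spread-merge spread) (large ∘ (_∘ q)))
  where open MergeIsolated a b x (punchIn x zero) (punchInᵢ≢i x zero ∘ sym) isolated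
... | no none-isolated with any? (λ i → degenerate? (a i) (b i))
short-rainbow-cut {suc n} {suc (suc w)} a b (acc rec) spread large | no _ | yes (i , degenerate)
  with degenerate-collapse (a i) (b i) degenerate
... | u , v , collapse with contract u v
... | w′ , w≤ , w′≤w , q , q-surj , qu≡qv =
  lift (short-rainbow-cut a′ b′ (rec (s≤s (+-monoʳ-≤ n w′≤w))) (spread-contract q-surj w≤ spread) (large-contract large))
  where open ContractColour a b i q (proj₁ (collapse q qu≡qv)) (proj₂ (collapse q qu≡qv))
short-rainbow-cut {n} {suc (suc w)} a b _ spread large | no none-isolated | no none-degenerate
  with any? (λ x → (doubled a b ⁅ x ⁆ᵇ ℕ.≟ 0) ×-dec (weight a b ⁅ x ⁆ᵇ + weight a b ⁅ x ⁆ᵇ ≤? n))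
... | yes (x , rainbow , short) = ⁅ x ⁆ᵇ ,
  decidable-stable (any? (crosses? a b ⁅ x ⁆ᵇ)) (λ ¬c → none-isolated (x , ¬c)) ,
  short , doubled-rainbow a b ⁅ x ⁆ᵇ rainbow
... | no none-good = contradiction (λ x good → none-good (x , good))
  (count-stars a b n+2≤ star-large λ i deg → none-degenerate (i , deg))
  where
  -- The constant labelling is flat on every edge, so `Spread` applies with `j = 1`.
  n+2≤ : n + 2 ≤ suc (suc w)
  n+2≤ = ≤-trans (≤-reflexive (+-comm n 2))
    (spread {1} (λ _ → zero) (λ { zero → zero , refl }) (λ _ → refl) (λ _ → refl))

  star-large : ∀ x → 3 ≤ weight a b ⁅ x ⁆ᵇ
  star-large x = decidable-stable (3 ≤? _) λ ¬3≤ →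
    none-isolated (x , λ (i , crosses) → ¬3≤ (large ⁅ x ⁆ᵇ i crosses))

-- Subsets and their sizes

∈-tabulate⁺ : {f : Fin m → Bool} {x : Fin m} → f x ≡ true → x ∈ tabulate f
∈-tabulate⁺ {f = f} {x} eq = lookup⇒[]= x (tabulate f) (trans (lookup∘tabulate f x) eq)

∈-tabulate⁻ : {f : Fin m → Bool} {x : Fin m} → x ∈ tabulate f → f x ≡ true
∈-tabulate⁻ {f = f} {x} x∈ = trans (sym (lookup∘tabulate f x)) ([]=⇒lookup x∈)

size-sum : (S : Subset m) → ∣ S ∣ ≡ sum (λ e → ⟦ lookup S e ⟧)
size-sum []          = refl
size-sum (true ∷ S)  = cong suc (size-sum S)
size-sum (false ∷ S) = size-sum S

size-remove : (S : Subset m) (x : Fin m) → ∣ S ∣ ≤ suc ∣ S - x ∣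
size-remove (true ∷ S)  zero    = s≤s (≤-reflexive (cong ∣_∣ (sym (p─⊥≡p S))))
size-remove (false ∷ S) zero    = ≤-trans (≤-reflexive (cong ∣_∣ (sym (p─⊥≡p S)))) (n≤1+n _)
size-remove (true ∷ S)  (suc x) = s≤s (size-remove S x)
size-remove (false ∷ S) (suc x) = size-remove S x

x∉p-x : (p : Subset m) (x : Fin m) → x ∉ p - x
x∉p-x (true ∷ p)  zero    ()
x∉p-x (false ∷ p) zero    ()
x∉p-x (s ∷ p)     (suc x) (there x∈) = x∉p-x p x x∈

nonempty-if-positive : (S : Subset m) → 1 ≤ ∣ S ∣ → Nonempty S
nonempty-if-positive (true ∷ S)  _ = zero , here
nonempty-if-positive (false ∷ S) p with nonempty-if-positive S p
... | x , x∈ = suc x , there x∈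

two-elements : (S : Subset m) → 2 ≤ ∣ S ∣ → Σ (Fin m) λ x → Σ (Fin m) λ y → x ∈ S × y ∈ S × x ≢ y
two-elements (true ∷ S) (s≤s p) with nonempty-if-positive S p
... | y , y∈ = zero , suc y , here , there y∈ , λ ()
two-elements (false ∷ S) p with two-elements S p
... | x , y , x∈ , y∈ , x≢y = suc x , suc y , there x∈ , there y∈ , x≢y ∘ Fin.suc-injective

-- Components, edge-cuts and cocycles

module Cocycles {m} (G : Graph m) where
  open Graph G

  ends₁ ends₂ : Fin m → Fin v
  ends₁ = proj₁ ∘ ends
  ends₂ = proj₂ ∘ ends

  ∉none : ∀ {e} → e ∉ none G
  ∉none e∈ with () ← ∈-tabulate⁻ {f = λ _ → false} e∈

  connected-mono : ∀ {S T x y} → T ⊆ S → Connected G S x y → Connected G T x y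
  connected-mono T⊆S here                = here
  connected-mono T⊆S (step e e∉S adj xy) = step e (e∉S ∘ T⊆S) adj (connected-mono T⊆S xy)

  connected-trans : ∀ {S x y z} → Connected G S x y → Connected G S y z → Connected G S x z
  connected-trans here                yz = yz
  connected-trans (step e e∉S adj xy) yz = step e e∉S adj (connected-trans xy yz)

  connected-flat : ∀ {S} {A : Set} {g : Fin v → A} → (∀ e → e ∉ S → Flat g (ends e)) →
                   ∀ {x y} → Connected G S x y → g x ≡ g y
  connected-flat flat here = refl
  connected-flat {g = g} flat (step e e∉S (inj₁ refl) xy) = trans (flat e e∉S) (connected-flat flat xy)
  connected-flat {g = g} flat (step e e∉S (inj₂ refl) xy) = trans (sym (flat e e∉S)) (connected-flat flat xy)

  label-flat : ∀ {S k} ((f , _) : HasComponents G S k) → ∀ e → e ∉ S → Flat f (ends e)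
  label-flat (f , _ , _ , conn⇒) e e∉S = conn⇒ _ _ (step e e∉S (inj₁ refl) here)

  relabel : ∀ {S T k} ((f , _) : HasComponents G S k) → T ⊆ S → (∀ e → e ∉ T → Flat f (ends e)) →
            HasComponents G T k
  relabel (f , surj , ⇒conn , _) T⊆S flat =
    f , surj , (λ x y eq → connected-mono T⊆S (⇒conn x y eq)) , λ x y → connected-flat flat

  remove-⊆ : ∀ (S : Subset m) e → S - e ⊆ S
  remove-⊆ S e = p─q⊆p S _

  ∉-remove : ∀ {S : Subset m} {e} (P : Fin m → Set) → P e → (∀ e′ → e′ ∉ S → P e′) → ∀ e′ → e′ ∉ S - e → P e′
  ∉-remove {S} {e} P Pe P∉ e′ e′∉ with e′ ≟ e
  ... | yes refl = Pe
  ... | no  ne   = P∉ e′ λ e′∈S → e′∉ (x∈p∧x≢y⇒x∈p-y e′∈S ne)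

  -- Restoring `e` fuses the two components at its ends and no others; by `merge-kernel`, each new
  -- identification is realised by a path through `e`.
  join : ∀ {S k} ((f , _) : HasComponents G S (suc k)) e → e ∈ S → ¬ Flat f (ends e) → HasComponents G (S - e) k
  join {S} {k} comps@(f , surj , ⇒conn , _) e e∈S f≢ =
    q ∘ f , q∘f-surj , connect , λ x y → connected-flat
      (∉-remove {S} (λ e → Flat (q ∘ f) (ends e)) (merge-identifies u u′ f≢) (λ e′ e′∉S → cong q (label-flat comps e′ e′∉S)))
    where
    u u′ : Fin (suc k)
    u = f (ends₁ e)
    u′ = f (ends₂ e)

    q : Fin (suc k) → Fin k
    q = merge u u′ f≢

    q∘f-surj : Surjection (q ∘ f)
    q∘f-surj i with merge-surjective u u′ f≢ i
    ... | c , refl with surj c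
    ... | x , refl = x , refl

    old : ∀ {x y} → f x ≡ f y → Connected G (S - e) x y
    old eq = connected-mono (remove-⊆ S e) (⇒conn _ _ eq)

    connect : ∀ x y → q (f x) ≡ q (f y) → Connected G (S - e) x y
    connect x y eq with merge-kernel u u′ f≢ (f x) (f y) eq
    ... | inj₁ same            = old same
    ... | inj₂ (inj₁ (p , p′)) = connected-trans (old p) (step e (x∉p-x S e) (inj₁ refl) (old (sym p′)))
    ... | inj₂ (inj₂ (p , p′)) = connected-trans (old p) (step e (x∉p-x S e) (inj₂ refl) (old (sym p′)))

  components-remove : ∀ {S k} → HasComponents G S k → ∀ e → e ∈ S → ∃ (HasComponents G (S - e))
  components-remove {S} {k} comps@(f , _) e e∈S with f (ends₁ e) ≟ f (ends₂ e)
  ... | yes eq = k , relabel comps (remove-⊆ S e) (∉-remove {S} (λ e → Flat f (ends e)) eq (label-flat comps))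
  components-remove {S} {zero}  (f , _) e e∈S | no _ with () ← f (ends₁ e)
  components-remove {S} {suc k} comps e e∈S | no ne = k , join comps e e∈S ne

  components-below : ∀ {S T k} → Acc _<_ ∣ S ∣ → T ⊆ S → HasComponents G S k → ∃ (HasComponents G T)
  components-below {S} {T} (acc rec) T⊆S comps with any? (λ e → (e ∈? S) ×-dec ¬? (e ∈? T))
  ... | yes (e , e∈S , e∉T) = components-below (rec (x∈p⇒∣p-x∣<∣p∣ e∈S))
    (λ {x} x∈T → x∈p∧x≢y⇒x∈p-y (T⊆S x∈T) λ { refl → e∉T x∈T })
    (proj₂ (components-remove comps e e∈S))
  ... | no ¬∃ = _ , subst (λ S → HasComponents G S _)
    (⊆-antisym (λ {e} e∈S → decidable-stable (e ∈? T) λ e∉T → ¬∃ (e , e∈S , e∉T)) T⊆S) comps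

  -- `EdgeCut` only quantifies over given labellings, so their existence must be supplied. With all
  -- edges deleted every vertex is a component; the edges outside `S` are then restored one by one.
  components : ∀ S → ∃ (HasComponents G S)
  components S = components-below (<-wellFounded _) (⊆-max S)
    (id , (λ i → i , refl) , (λ { x .x refl → here }) , λ x y → connected-flat {S = ⊤} (λ e e∉⊤ → contradiction ∈⊤ e∉⊤))

  -- Vertices with different `g`-labels lie in different components, so choosing one vertex per
  -- label gives an injection.
  fewer-labels : ∀ {S j k} (g : Fin v → Fin j) → Surjection g → (∀ {x y} → Connected G S x y → g x ≡ g y) →
                 HasComponents G S k → j ≤ k
  fewer-labels {j = j} {k} g g-surj flat (f , _ , ⇒conn , _) = injective⇒≤ {f = h} injective
    where
    rep : Fin j → Fin v
    rep i = proj₁ (g-surj i)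

    h : Fin j → Fin k
    h i = f (rep i)

    injective : ∀ {i i′} → h i ≡ h i′ → i ≡ i′
    injective {i} {i′} eq = trans (sym (proj₂ (g-surj i))) (trans (flat (⇒conn _ _ eq)) (proj₂ (g-surj i′)))

  components-mono : ∀ {S T k l} → T ⊆ S → HasComponents G T k → HasComponents G S l → k ≤ l
  components-mono T⊆S (g , surj , _ , conn⇒) = fewer-labels g surj (λ c → conn⇒ _ _ (connected-mono T⊆S c))

  components-unique : ∀ {S k l} → HasComponents G S k → HasComponents G S l → k ≡ l
  components-unique p q = ≤-antisym (components-mono ⊆-refl p q) (components-mono ⊆-refl q p)

  module Split {S T k l} (T⊆S : T ⊆ S) (T-comps : HasComponents G T k) (S-comps : HasComponents G S l) where
    f = proj₁ T-comps
    g = proj₁ S-comps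

    coarser : ∀ {x y} → g x ≡ g y → f x ≡ f y
    coarser eq = proj₂ (proj₂ (proj₂ T-comps)) _ _ (connected-mono T⊆S (proj₁ (proj₂ (proj₂ S-comps)) _ _ eq))

    rep : Fin k → Fin v
    rep i = proj₁ (proj₁ (proj₂ T-comps) i)

    f-rep : ∀ i → f (rep i) ≡ i
    f-rep i = proj₂ (proj₁ (proj₂ T-comps) i)

    -- The representatives of the `T`-components lie in distinct `S`-components, and the
    -- `S`-component of `z` contains none of them.
    new-component : ∀ z → g z ≢ g (rep (f z)) → k < l
    new-component z z-new = injective⇒≤ {f = h} injective
      where
      h : Fin (suc k) → Fin l
      h zero    = g z
      h (suc i) = g (rep i)

      not-rep : ∀ i → g z ≢ g (rep i)
      not-rep i eq = z-new (trans eq (cong (g ∘ rep) (sym (trans (coarser eq) (f-rep i)))))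

      injective : ∀ {i j} → h i ≡ h j → i ≡ j
      injective {zero}  {zero}  eq = refl
      injective {zero}  {suc j} eq = contradiction eq (not-rep j)
      injective {suc i} {zero}  eq = contradiction (sym eq) (not-rep i)
      injective {suc i} {suc j} eq = cong suc (trans (sym (f-rep i)) (trans (coarser eq) (f-rep j)))

    split : ∀ x y → f x ≡ f y → g x ≢ g y → k < l
    split x y fx≡fy gx≢gy with g x ≟ g (rep (f x))
    ... | no  x-new = new-component x x-new
    ... | yes x-old = new-component y λ y-old →
      gx≢gy (trans x-old (trans (cong (g ∘ rep) fx≡fy) (sym y-old)))

  -- Component counts exist and are unique, so the quantified condition reduces to one comparison.
  edgeCut? : ∀ S → Dec (EdgeCut G S)
  edgeCut? S with components (none G) | components S
  ... | k , none-comps | l , S-comps with k <? l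
  ... | yes k<l = yes λ k′ l′ p q → subst₂ _<_ (components-unique none-comps p) (components-unique S-comps q) k<l
  ... | no  k≮l = no λ cut → k≮l (cut k l none-comps S-comps)

  edgeCut-mono : ∀ {S T} → T ⊆ S → EdgeCut G T → EdgeCut G S
  edgeCut-mono {S} {T} T⊆S T-cut k l none-comps S-comps with components T
  ... | l′ , T-comps = <-≤-trans (T-cut k l′ none-comps T-comps) (components-mono T⊆S T-comps S-comps)

  -- Edges are removed as long as an edge-cut remains. Since edge-cuts are closed under supersets, a
  -- set from which no single edge can be removed is minimal.
  cocycle-within : ∀ S → Acc _<_ ∣ S ∣ → EdgeCut G S → Σ (Subset m) λ C → C ⊆ S × Cocycle G C
  cocycle-within S (acc rec) S-cut with any? (λ e → (e ∈? S) ×-dec edgeCut? (S - e))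
  ... | yes (e , e∈S , smaller) with cocycle-within (S - e) (rec (x∈p⇒∣p-x∣<∣p∣ e∈S)) smaller
  ...   | C , C⊆ , cocycle = C , ⊆-trans C⊆ (remove-⊆ S e) , cocycle
  cocycle-within S (acc rec) S-cut | no ¬∃ = S , ⊆-refl , S-cut , λ T T⊆S T-cut →
    ⊆-antisym T⊆S λ {e} e∈S → decidable-stable (e ∈? T) λ e∉T →
      ¬∃ (e , e∈S , edgeCut-mono (λ {x} x∈T → x∈p∧x≢y⇒x∈p-y (T⊆S x∈T) λ { refl → e∉T x∈T }) T-cut)

  coboundary : (Fin v → Bool) → Subset m
  coboundary X = tabulate (λ e → cut X (ends e))

  -- After the deletion `X` is constant on components, while the ends of `e` differ in `X`; hence
  -- the component of `G` containing `e` has been split.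
  coboundary-edgeCut : ∀ X e → cut X (ends e) ≡ true → EdgeCut G (coboundary X)
  coboundary-edgeCut X e crosses k l none-comps S-comps@(g , _ , ⇒conn , _) =
    Split.split (λ e∈ → contradiction e∈ ∉none) none-comps S-comps (ends₁ e) (ends₂ e)
      (label-flat none-comps e ∉none)
      (λ eq → contradiction (trans (sym crosses) (xor-same (X-flat (⇒conn _ _ eq)))) λ ())
    where
    X-flat : ∀ {x y} → Connected G (coboundary X) x y → X x ≡ X y
    X-flat = connected-flat λ e e∉ → uncut⇒flat X (ends e) (e∉ ∘ ∈-tabulate⁺)

  -- I is what remains of S after deleting a spanning forest of the contraction G / (E - S).
  maximal-nonseparating : ∀ w S → HasComponents G S w → Σ (Subset m) λ I → Σ ℕ λ k →
    HasComponents G I k × HasComponents G (none G) k × k + ∣ S ∣ ≤ ∣ I ∣ + w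
  maximal-nonseparating w S comps@(f , _) with any? (λ e → (e ∈? S) ×-dec ¬? (f (ends₁ e) ≟ f (ends₂ e)))
  -- No edge of `S` joins two components, so deleting `S` separates nothing and the forest is empty.
  ... | no ¬∃ = S , w , comps , relabel comps (λ e∈ → contradiction e∈ ∉none) flat , ≤-reflexive (+-comm w ∣ S ∣)
    where
    flat : ∀ e → e ∉ none G → Flat f (ends e)
    flat e _ with e ∈? S
    ... | yes e∈S = decidable-stable (_ ≟ _) λ ne → ¬∃ (e , e∈S , ne)
    ... | no  e∉S = label-flat comps e e∉S
  maximal-nonseparating zero S (f , _) | yes (e , _) with () ← f (ends₁ e)
  maximal-nonseparating (suc w) S comps | yes (e , e∈S , ne)
    with maximal-nonseparating w (S - e) (join comps e e∈S ne)
  ... | I , k , I-comps , none-comps , size = I , k , I-comps , none-comps , (begin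
    k + ∣ S ∣          ≤⟨ +-monoʳ-≤ k (size-remove S e) ⟩
    k + suc ∣ S - e ∣  ≡⟨ +-suc k _ ⟩
    suc (k + ∣ S - e ∣) ≤⟨ s≤s size ⟩
    suc (∣ I ∣ + w)    ≡⟨ +-suc ∣ I ∣ w ⟨
    ∣ I ∣ + suc w      ∎)
    where open ≤-Reasoning

  -- By monotonicity, deleting a part of `I` creates no component either. This makes `I` independent
  -- in the cocycle matroid.
  nonseparating-no-edgeCut : ∀ {I k} → HasComponents G I k → HasComponents G (none G) k →
    ∀ C → C ⊆ I → ¬ EdgeCut G C
  nonseparating-no-edgeCut I-comps none-comps C C⊆I C-cut with components C
  ... | l , C-comps = <-irrefl refl (<-≤-trans (C-cut _ l none-comps C-comps) (components-mono C⊆I C-comps I-comps))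

-- Counting with two chosen edges per colour

-- Double counting: every counted `e` is hit by some `a i` or `b i`, and each of these hits only one
-- `e`. It bounds the size of a cut by its `weight`.
covered-count : (a b : Fin n → Fin m) (h : Fin m → Bool) →
  (∀ e → h e ≡ true → ∃ λ i → a i ≡ e ⊎ b i ≡ e) →
  sum (λ e → ⟦ h e ⟧) ≤ sum (λ i → ⟦ h (a i) ⟧ + ⟦ h (b i) ⟧)
covered-count {n} {m} a b h cover = begin
  sum (λ e → ⟦ h e ⟧)                      ≤⟨ sum-mono-≤ per-edge ⟩
  sum (λ e → sum (λ i → at a i e + at b i e)) ≡⟨ ∑-comm (λ e i → at a i e + at b i e) ⟩
  sum (λ i → sum (λ e → at a i e + at b i e)) ≤⟨ sum-mono-≤ per-colour ⟩
  sum (λ i → ⟦ h (a i) ⟧ + ⟦ h (b i) ⟧)    ∎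
  where
  open ≤-Reasoning
  at : (Fin n → Fin m) → Fin n → Fin m → ℕ
  at a i e = ⟦ does (a i ≟ e) ∧ h e ⟧

  at-self : ∀ a i → at a i (a i) ≡ ⟦ h (a i) ⟧
  at-self a i rewrite ≟-refl (a i) = refl

  per-edge : ∀ e → ⟦ h e ⟧ ≤ sum (λ i → at a i e + at b i e)
  per-edge e with h e Bool.≟ true
  ... | no uncovered = ≤-trans (≤-reflexive (cong ⟦_⟧ (Bool.¬-not uncovered))) z≤n
  ... | yes covered with cover e covered
  ... | i , inj₁ refl = ≤-trans (≤-reflexive (sym (at-self a i)))
    (≤-trans (m≤m+n _ _) (term≤sum (λ j → at a j e + at b j e) i))
  ... | i , inj₂ refl = ≤-trans (≤-reflexive (sym (at-self b i)))
    (≤-trans (m≤n+m _ _) (term≤sum (λ j → at a j e + at b j e) i))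

  sum-at : ∀ a i → sum (at a i) ≤ ⟦ h (a i) ⟧
  sum-at a i = sum-concentrated (at a i) _ bound λ e e′ p q →
    trans (sym (at-≢0 e p)) (at-≢0 e′ q)
    where
    at-≢0 : ∀ e → at a i e ≢ 0 → a i ≡ e
    at-≢0 e p = ≟-true (a i) e (proj₁ (∧-true (⟦⟧≢0 p)))
    bound : ∀ e → at a i e ≤ ⟦ h (a i) ⟧
    bound e = ⟦⟧-mono λ eq → let p , q = ∧-true eq in trans (cong h (≟-true (a i) e p)) q

  per-colour : ∀ i → sum (λ e → at a i e + at b i e) ≤ ⟦ h (a i) ⟧ + ⟦ h (b i) ⟧
  per-colour i = ≤-trans (≤-reflexive (∑-distrib-+ (at a i) (at b i))) (+-mono-≤ (sum-at a i) (sum-at b i))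

module TwoPerColour {m n} (c : Fin m → Fin n) (a b : Fin n → Fin m)
  (c-a : ∀ i → c (a i) ≡ i) (c-b : ∀ i → c (b i) ≡ i) (a≢b : ∀ i → a i ≢ b i) where

  chosen : Fin m → Bool
  chosen e = does (a (c e) ≟ e) ∨ does (b (c e) ≟ e)

  chosen-a : ∀ i → chosen (a i) ≡ true
  chosen-a i rewrite c-a i | ≟-refl (a i) = refl

  chosen-b : ∀ i → chosen (b i) ≡ true
  chosen-b i rewrite c-b i | ≟-refl (b i) = Bool.∨-zeroʳ _

  chosen⁻ : ∀ e → chosen e ≡ true → a (c e) ≡ e ⊎ b (c e) ≡ e
  chosen⁻ e eq with a (c e) ≟ e | b (c e) ≟ e
  ... | yes p | _     = inj₁ p
  ... | no _  | yes q = inj₂ q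

  -- Each colour contributes two distinct edges, and an edge is counted only for its own colour.
  chosen-count : n + n ≤ sum (λ e → ⟦ chosen e ⟧)
  chosen-count = begin
    n + n                                                   ≡⟨ n+n≡n*2 n ⟩
    n * 2                                                   ≡⟨ sum-const n 2 ⟨
    sum (λ (_ : Fin n) → 2)                                 ≤⟨ sum-mono-≤ per-colour ⟩
    sum (λ i → sum (λ e → at i e))                          ≡⟨ ∑-comm at ⟩
    sum (λ e → sum (λ i → at i e))                          ≤⟨ sum-mono-≤ per-edge ⟩
    sum (λ e → ⟦ chosen e ⟧)                                ∎
    where
    open ≤-Reasoning
    n+n≡n*2 : ∀ n → n + n ≡ n * 2
    n+n≡n*2 = solve-∀

    at : Fin n → Fin m → ℕ
    at i e = ⟦ does (a i ≟ e) ⟧ + ⟦ does (b i ≟ e) ⟧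

    self : ∀ (x : Fin m) → 1 ≤ sum (λ e → ⟦ does (x ≟ e) ⟧)
    self x = ≤-trans (≤-reflexive (cong ⟦_⟧ (sym (≟-refl x)))) (term≤sum (λ e → ⟦ does (x ≟ e) ⟧) x)

    per-colour : ∀ i → 2 ≤ sum (at i)
    per-colour i = ≤-trans (+-mono-≤ (self (a i)) (self (b i)))
      (≤-reflexive (sym (∑-distrib-+ (λ e → ⟦ does (a i ≟ e) ⟧) _)))

    at-≤ : ∀ e i → at i e ≤ ⟦ chosen e ⟧
    at-≤ e i with a i ≟ e | b i ≟ e
    ... | yes p    | yes q    = contradiction (trans p (sym q)) (a≢b i)
    ... | yes refl | no _     = ≤-reflexive (cong ⟦_⟧ (sym (chosen-a i)))
    ... | no _     | yes refl = ≤-reflexive (cong ⟦_⟧ (sym (chosen-b i)))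
    ... | no _     | no _     = z≤n

    at-≢0 : ∀ e i → at i e ≢ 0 → c e ≡ i
    at-≢0 e i p with a i ≟ e | b i ≟ e
    ... | yes refl | _        = c-a i
    ... | no _     | yes refl = c-b i
    ... | no _     | no _     = contradiction refl p

    per-edge : ∀ e → sum (λ i → at i e) ≤ ⟦ chosen e ⟧
    per-edge e = sum-concentrated (λ i → at i e) _ (at-≤ e) λ i j p q → trans (sym (at-≢0 e i p)) (at-≢0 e j q)

-- From the cographic matroid to the contracted graph and back

theorem4p2 : ∀ {m} (N : Matroid m) (n r : ℕ) → suc r ≡ n →
    Simple N → Cographic N → HasRank N r →
    (c : Fin m → Fin n) → (∀ i → 2 ≤ ∣ colourClass c i ∣) →
    Σ (Subset m) λ C → Matroid.Circuit N C × ∣ C ∣ ≤ ⌈ n /2⌉ × Rainbow c C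
theorem4p2 {m} N n r refl simple (G , circuit⇔cocycle) (_ , rank-max) c big = result
  where
  open Matroid N using (Circuit; nonempty)
  open Cocycles G

  pair : ∀ i → Σ (Fin m) λ x → Σ (Fin m) λ y → x ∈ colourClass c i × y ∈ colourClass c i × x ≢ y
  pair i = two-elements (colourClass c i) (big i)

  colour : ∀ {e i} → e ∈ colourClass c i → c e ≡ i
  colour {e} {i} e∈ = ≟-true (c e) i (∈-tabulate⁻ e∈)

  a b : Fin n → Fin m
  a i = proj₁ (pair i)
  b i = proj₁ (proj₂ (pair i))

  open TwoPerColour c a b
    (λ i → colour (proj₁ (proj₂ (proj₂ (pair i)))))
    (λ i → colour (proj₁ (proj₂ (proj₂ (proj₂ (pair i))))))
    (λ i → proj₂ (proj₂ (proj₂ (proj₂ (pair i)))))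

  A : Subset m
  A = tabulate chosen

  2n≤∣A∣ : n + n ≤ ∣ A ∣
  2n≤∣A∣ = begin
    n + n                        ≤⟨ chosen-count ⟩
    sum (λ e → ⟦ chosen e ⟧)     ≤⟨ sum-mono-≤ (λ e → ≤-reflexive (cong ⟦_⟧ (sym (lookup∘tabulate chosen e)))) ⟩
    sum (λ e → ⟦ lookup A e ⟧)   ≡⟨ size-sum A ⟨
    ∣ A ∣                        ∎
    where open ≤-Reasoning

  v′ : ℕ
  v′ = proj₁ (components A)

  -- Fin v′ is the vertex set of the contraction G / (E - A).
  A-comps : HasComponents G A v′
  A-comps = proj₂ (components A)

  p : Fin (Graph.v G) → Fin v′
  p = proj₁ A-comps

  a′ b′ : Fin n → Edge v′
  a′ i = mapEdge p (Graph.ends G (a i))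
  b′ i = mapEdge p (Graph.ends G (b i))

  circuit-within : ∀ S → EdgeCut G S → Σ (Subset m) λ C → C ⊆ S × Circuit C
  circuit-within S S-cut with cocycle-within S (<-wellFounded _) S-cut
  ... | C , C⊆S , cocycle = C , C⊆S , proj₂ (circuit⇔cocycle C) cocycle

  nonseparating-small : ∀ {I k} → HasComponents G I k → HasComponents G (none G) k → ∣ I ∣ ≤ r
  nonseparating-small {I} I-comps none-comps = rank-max I λ C circuit C⊆I →
    nonseparating-no-edgeCut I-comps none-comps C C⊆I (proj₁ (proj₁ (circuit⇔cocycle C) circuit))

  -- A nonseparating subset of `A` is independent, hence of size at most `r`. With at least `2 n`
  -- edges in `A` this gives `j + 2 n ≤ r + v′`, and `n = r + 1`.
  spread : Spread a′ b′
  spread {j} g g-surj ga gb with maximal-nonseparating v′ A A-comps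
  ... | I , k , I-comps , none-comps , size = +-cancelˡ-≤ r _ _ (begin
    r + (j + suc n)   ≡⟨ rearrange r j ⟩
    j + (n + n)       ≤⟨ +-mono-≤ (fewer-labels (g ∘ p) surj (connected-flat flat) none-comps) 2n≤∣A∣ ⟩
    k + ∣ A ∣         ≤⟨ size ⟩
    ∣ I ∣ + v′         ≤⟨ +-monoˡ-≤ v′ (nonseparating-small I-comps none-comps) ⟩
    r + v′             ∎)
    where
    open ≤-Reasoning
    rearrange : ∀ r j → r + (j + suc (suc r)) ≡ j + (suc r + suc r)
    rearrange = solve-∀

    surj : Surjection (g ∘ p)
    surj i with g-surj i
    ... | y , refl with proj₁ (proj₂ A-comps) y
    ... | x , refl = x , refl

    flat : ∀ e → e ∉ none G → Flat (g ∘ p) (Graph.ends G e)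
    flat e _ with e ∈? A
    ... | no e∉A = cong g (label-flat A-comps e e∉A)
    ... | yes e∈A with chosen⁻ e (∈-tabulate⁻ e∈A)
    ... | inj₁ eq = subst (Flat (g ∘ p) ∘ Graph.ends G) eq (ga (c e))
    ... | inj₂ eq = subst (Flat (g ∘ p) ∘ Graph.ends G) eq (gb (c e))

  δ : (Fin v′ → Bool) → Subset m
  δ X = coboundary (X ∘ p)

  -- An edge outside `A` is contracted to a loop, and no cut contains a loop.
  δ-chosen : ∀ X e → cut (X ∘ p) (Graph.ends G e) ≡ true → a (c e) ≡ e ⊎ b (c e) ≡ e
  δ-chosen X e crosses with e ∈? A
  ... | yes e∈A = chosen⁻ e (∈-tabulate⁻ e∈A)
  ... | no  e∉A = contradiction
    (trans (sym crosses) (flat⇒uncut p X (Graph.ends G e) (label-flat A-comps e e∉A))) λ ()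

  ∣δ∣≤weight : ∀ X → ∣ δ X ∣ ≤ weight a′ b′ X
  ∣δ∣≤weight X = begin
    ∣ δ X ∣                                          ≡⟨ size-sum (δ X) ⟩
    sum (λ e → ⟦ lookup (δ X) e ⟧)                   ≤⟨ sum-mono-≤ (λ e → ≤-reflexive (cong ⟦_⟧ (lookup∘tabulate h e))) ⟩
    sum (λ e → ⟦ h e ⟧)                              ≤⟨ covered-count a b h (λ e crosses → c e , δ-chosen X e crosses) ⟩
    weight a′ b′ X                                   ∎
    where
    open ≤-Reasoning
    h : Fin m → Bool
    h e = cut (X ∘ p) (Graph.ends G e)

  circuit-in-δ : ∀ X i → Crosses a′ b′ X i → Σ (Subset m) λ C → C ⊆ δ X × Circuit C
  circuit-in-δ X i (inj₁ crosses) = circuit-within (δ X) (coboundary-edgeCut (X ∘ p) (a i) crosses)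
  circuit-in-δ X i (inj₂ crosses) = circuit-within (δ X) (coboundary-edgeCut (X ∘ p) (b i) crosses)

  circuit-size : ∀ C → Circuit C → 3 ≤ ∣ C ∣
  circuit-size C circuit = ≤∧≢⇒< (≤∧≢⇒< positive (proj₁ (simple C circuit) ∘ sym)) (proj₂ (simple C circuit) ∘ sym)
    where
    positive : 1 ≤ ∣ C ∣
    positive with nonempty C circuit
    ... | x , x∈C = ≤-<-trans z≤n (x∈p⇒∣p-x∣<∣p∣ x∈C)

  large : LargeCuts a′ b′
  large X i crosses with circuit-in-δ X i crosses
  ... | C , C⊆δ , circuit = ≤-trans (circuit-size C circuit) (≤-trans (p⊆q⇒∣p∣≤∣q∣ C⊆δ) (∣δ∣≤weight X))

  half : ∀ {x} → x + x ≤ n → x ≤ ⌈ n /2⌉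
  half {x} 2x≤n = begin
    x             ≡⟨ n≡⌊n+n/2⌋ x ⟩
    ⌊ x + x /2⌋   ≤⟨ ⌊n/2⌋-mono 2x≤n ⟩
    ⌊ n /2⌋       ≤⟨ ⌊n/2⌋≤⌈n/2⌉ n ⟩
    ⌈ n /2⌉       ∎
    where open ≤-Reasoning

  result : Σ (Subset m) λ C → Circuit C × ∣ C ∣ ≤ ⌈ n /2⌉ × Rainbow c C
  result with short-rainbow-cut a′ b′ (<-wellFounded _) spread large
  -- The cut itself need not be minimal; a circuit inside it inherits both the size bound and
  -- distinct colours.
  ... | X , (i , crosses) , short , rainbow with circuit-in-δ X i crosses
  ... | C , C⊆δ , circuit = C , circuit , size , distinct
    where
    size : ∣ C ∣ ≤ ⌈ n /2⌉
    size = ≤-trans (p⊆q⇒∣p∣≤∣q∣ C⊆δ) (≤-trans (∣δ∣≤weight X) (half short))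

    crossing : ∀ e → e ∈ C → cut (X ∘ p) (Graph.ends G e) ≡ true
    crossing e e∈C = ∈-tabulate⁻ (C⊆δ e∈C)

    not-both : ∀ {x y i} → a i ≡ x → b i ≡ y → x ∈ C → ¬ y ∈ C
    not-both {i = i} refl refl x∈C y∈C = rainbow i (crossing _ x∈C) (crossing _ y∈C)

    distinct : Rainbow c C
    -- Every edge of the cut is `a i` or `b i` for its colour `i`, so two distinct ones of the same
    -- colour would be both, against `rainbow`.
    distinct x y x∈C y∈C same with δ-chosen X x (crossing x x∈C) | δ-chosen X y (crossing y y∈C)
    ... | inj₁ ax | inj₁ ay = trans (sym ax) (trans (cong a same) ay)
    ... | inj₂ bx | inj₂ by = trans (sym bx) (trans (cong b same) by)
    ... | inj₁ ax | inj₂ by = contradiction y∈C (not-both (trans (cong a (sym same)) ax) by x∈C)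
    ... | inj₂ bx | inj₁ ay = contradiction x∈C (not-both ay (trans (cong b (sym same)) bx) y∈C)
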